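{- Let $r\geq 3$ be an integer and let $M$ be a matroid of rank $r$, on a finite or infinite ground set, that has two hyperplanes $H$ and $H'$ with $H\cap H'=\emptyset$. Then $M$ is not sticky.
   Context: Matroids may have finite or infinite ground sets; all matroids considered have finite rank. $E(M)$ denotes the ground set of $M$. A hyperplane of a rank-$r$ matroid is a flat of rank $r-1$. Given matroids $N$ and $N'$ whose restrictions to $E(N)\cap E(N')$ are equal, an amalgam of $N$ and $N'$ is a matroid on $E(N)\cup E(N')$ having both $N$ and $N'$ as restrictions. A matroid $M$ is sticky if, whenever $N$ and $N'$ are matroids whose restrictions to $E(N)\cap E(N')$ are equal to each other and isomorphic to $M$, the matroids $N$ and $N'$ have an amalgam. -}

module Defs where

open import Data.List.Base using (List; length)
open import Data.List.Membership.Propositional using () renaming (_∈_ to _∈ˡ_)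
open import Data.List.Relation.Unary.Unique.Propositional using (Unique)
open import Data.Nat.Base using (ℕ; suc; _≤_; _<_)
open import Data.Product.Base using (Σ; ∃; _×_; _,_; proj₁; proj₂)
open import Data.Sum.Base using (inj₁; inj₂)
open import Function.Bundles using (Bijection; _⇔_)
open import Level using (Level) renaming (suc to lsuc)
open import Relation.Binary.Bundles using (Setoid)
import Relation.Binary.Construct.On as On
open import Relation.Binary.PropositionalEquality.Core using (_≡_; refl)
open import Relation.Binary.PropositionalEquality.Properties using (setoid)
open import Relation.Unary using (Pred; _∈_; _∉_; _⊆_; _≐_; _∪_; _∩_; ｛_｝)
open import Relation.Unary.Polymorphic using (∅)

private
  variable
    ℓ : Level

-- Subsets of U are predicates, compared by mutual inclusion _≐_.
Subset : Set ℓ → Set (lsuc ℓ)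
Subset {ℓ} U = Pred U ℓ

HasSize : {U : Set ℓ} → Subset U → ℕ → Set ℓ
HasSize {U = U} X n =
  Σ (List U) λ xs → Unique xs × length xs ≡ n × (X ≐ (_∈ˡ xs))

-- Matroids of finite rank whose ground set E is an arbitrary (possibly
-- infinite) subset of U, given by their independent sets.  Finite rank is
-- the last axiom: the independent sets are finite, of bounded size.
-- Since indep-⊆ is stated for inclusion of predicates, Indep respects _≐_.
record Matroid (U : Set ℓ) : Set (lsuc ℓ) where
  field
    E             : Subset U
    Indep         : Pred (Subset U) ℓ
    indep-ground  : ∀ {I} → Indep I → I ⊆ E
    indep-∅       : Indep ∅
    indep-⊆       : ∀ {I J} → J ⊆ I → Indep I → Indep J
    indep-augment : ∀ {I J m n} → Indep I → Indep J →
                    HasSize I m → HasSize J n → m < n →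
                    ∃ λ e → e ∈ J × e ∉ I × Indep (I ∪ ｛ e ｝)
    finite-rank   : ∃ λ k → ∀ {I} → Indep I → ∃ λ n → n ≤ k × HasSize I n

open Matroid public

-- The rank of X is k: a largest independent subset of X has k elements.
HasRank : {U : Set ℓ} → Matroid U → Subset U → ℕ → Set (lsuc ℓ)
HasRank M X k =
    (∃ λ I → I ⊆ X × Indep M I × HasSize I k)
  × (∀ {I n} → I ⊆ X → Indep M I → HasSize I n → n ≤ k)

-- F contains every element of E whose addition does not raise the rank.
IsFlat : {U : Set ℓ} → Matroid U → Subset U → Set (lsuc ℓ)
IsFlat M F =
  F ⊆ E M × (∀ {e k} → e ∈ E M → HasRank M F k → HasRank M (F ∪ ｛ e ｝) k → e ∈ F)

IsHyperplane : {U : Set ℓ} → Matroid U → Subset U → Set (lsuc ℓ)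
IsHyperplane M H =
  IsFlat M H × ∃ λ k → HasRank M H k × HasRank M (E M) (suc k)

infixl 8 _∣_
_∣_ : {U : Set ℓ} → Matroid U → Subset U → Matroid U
M ∣ T = record
  { E             = E M ∩ T
  ; Indep         = λ I → Indep M I × I ⊆ T
  ; indep-ground  = λ (i , I⊆T) x∈I → indep-ground M i x∈I , I⊆T x∈I
  ; indep-∅       = indep-∅ M , λ ()
  ; indep-⊆       = λ J⊆I (i , I⊆T) → indep-⊆ M J⊆I i , λ x∈J → I⊆T (J⊆I x∈J)
  ; indep-augment = λ (i , I⊆T) (j , J⊆T) sI sJ m<n →
      let e , e∈J , e∉I , i+e = indep-augment M i j sI sJ m<n
      in  e , e∈J , e∉I , i+e , λ { (inj₁ x∈I) → I⊆T x∈I ; (inj₂ refl) → J⊆T e∈J }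
  ; finite-rank   = let k , bound = finite-rank M in k , λ (i , _) → bound i
  }

infix 4 _≈_
_≈_ : {U : Set ℓ} → Matroid U → Matroid U → Set (lsuc ℓ)
M ≈ N = E M ≐ E N × (∀ I → Indep M I ⇔ Indep N I)

-- The elements of E M.  Membership proofs are ignored by the equality, since
-- a predicate may have several proofs at the same point.
elements : {U : Set ℓ} → Matroid U → Setoid ℓ ℓ
elements {U = U} M = On.setoid {B = ∃ (E M)} (setoid U) proj₁

image : {U V : Set ℓ} (M : Matroid U) (N : Matroid V) →
        Bijection (elements M) (elements N) → Subset U → Subset V
image M N φ X v =
  Σ (∃ (E M)) λ e → proj₁ e ∈ X × proj₁ (Bijection.to φ e) ≡ v

infix 4 _≅_
_≅_ : {U V : Set ℓ} → Matroid U → Matroid V → Set (lsuc ℓ)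
M ≅ N = Σ (Bijection (elements M) (elements N)) λ φ →
  ∀ I → I ⊆ E M → Indep M I ⇔ Indep N (image M N φ I)

IsAmalgam : {U : Set ℓ} → Matroid U → Matroid U → Matroid U → Set (lsuc ℓ)
IsAmalgam A N N′ = E A ≐ (E N ∪ E N′) × A ∣ E N ≈ N × A ∣ E N′ ≈ N′

Sticky : {U : Set ℓ} → Matroid U → Set (lsuc ℓ)
Sticky {ℓ} M =
  {V : Set ℓ} (N N′ : Matroid V) →
  let T = E N ∩ E N′ in
  N ∣ T ≈ N′ ∣ T → N ∣ T ≅ M → N′ ∣ T ≅ M →
  Σ (Matroid V) λ A → IsAmalgam A N N′

{-# OPTIONS --safe #-}
module Submission where

-- A Vámos-type configuration.  Let M have rank r.  The matroid N adds r − 2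
-- independent points P to both hyperplanes; N′, of rank r + 1, adds blocks
-- C and D such that H ∪ C, H ∪ D, H′ ∪ C, H′ ∪ D have rank r while C ∪ D
-- spans.  In an amalgam P lies in the closures of H and of H′, so
-- submodularity on H ∪ C ∪ P and H′ ∪ C ∪ P gives rank (C ∪ P) ≤ r − 1, and
-- likewise for D.  As P has rank r − 2, a last submodularity step gives
-- rank (C ∪ D) ≤ r, a contradiction.

open import Axiom.ExcludedMiddle using (ExcludedMiddle)
open import Data.Bool.Base using (Bool; true; false)
open import Data.Bool.Properties using () renaming (_≟_ to _≟ᵇ_)
open import Data.Empty using (⊥; ⊥-elim)
open import Data.Fin.Base using (Fin)
open import Data.List.Base using (List; []; _∷_; _++_; map; filter; length; allFin)
open import Data.List.Membership.Propositional using () renaming (_∈_ to _∈ˡ_)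
open import Data.List.Membership.Propositional.Properties
  using (∈-∃++; ∈-++⁻; ∈-++⁺ˡ; ∈-++⁺ʳ; ∈-map⁺; ∈-map⁻; ∈-filter⁺; ∈-filter⁻; ∈-allFin)
open import Data.List.Properties
  using (length-++; length-++-sucʳ; length-map; length-filter; length-tabulate)
open import Data.List.Relation.Unary.All using ([])
open import Data.List.Relation.Unary.AllPairs using ([]; _∷_)
open import Data.List.Relation.Unary.Any using (here; there)
open import Data.List.Relation.Unary.Unique.Propositional using (Unique)
open import Data.List.Relation.Unary.Unique.Propositional.Properties
  using (map⁺; ++⁺; filter⁺; allFin⁺; Unique[x∷xs]⇒x∉xs)
open import Data.Maybe.Base using (Maybe; just; nothing)
open import Data.Nat.Base using (ℕ; zero; suc; _+_; _≤_; _<_; _≥_; z≤n; s≤s)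
open import Data.Nat.Properties
open import Data.Product.Base using (∃; _×_; _,_; proj₁; proj₂)
open import Data.Sum.Base using (_⊎_; inj₁; inj₂; [_,_])
open import Data.Sum.Properties using (inj₁-injective; inj₂-injective)
open import Data.Unit.Polymorphic using (tt)
open import Function.Base using (_∘_; id)
open import Function.Bundles using (Bijection; Equivalence; _⇔_; mk⇔)
open import Level using (Level; Lift; lift; lower) renaming (suc to lsuc)
open import Relation.Binary.PropositionalEquality
  using (_≡_; _≢_; refl; sym; trans; cong; cong₂; subst)
open import Relation.Nullary.Decidable using (Dec; yes; no; map′)
open import Relation.Nullary.Negation using (¬_; contradiction)
open import Relation.Unary
  using (Empty; _∈_; _∉_; _⊆_; _≐_; _∪_; _∩_; _∖_; ｛_｝; _⟨⊎⟩_)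
open import Relation.Unary.Polymorphic using (∅) renaming (U to Full)
open import Defs

private
  variable
    ℓ : Level
    U W : Set ℓ
    a b j k m n : ℕ

-- Cardinalities of finite subsets.

Unique∧⊆⇒length≤ : {xs ys : List U} → Unique xs → (_∈ˡ xs) ⊆ (_∈ˡ ys) → length xs ≤ length ys
Unique∧⊆⇒length≤ {xs = []}     _          _     = z≤n
-- The head is deleted from `ys`; by uniqueness the tail still lies in what remains.
Unique∧⊆⇒length≤ {xs = x ∷ xs} u@(_ ∷ u′) xs⊆ys
  with as , bs , refl ← ∈-∃++ (xs⊆ys (here refl)) =
  subst (suc (length xs) ≤_) (sym (length-++-sucʳ as x bs)) (s≤s (Unique∧⊆⇒length≤ u′ rest))
  where
  rest : (_∈ˡ xs) ⊆ (_∈ˡ (as ++ bs))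
  rest z∈xs with ∈-++⁻ as (xs⊆ys (there z∈xs))
  ... | inj₁ z∈as         = ∈-++⁺ˡ z∈as
  ... | inj₂ (here refl)  = contradiction z∈xs (Unique[x∷xs]⇒x∉xs u)
  ... | inj₂ (there z∈bs) = ∈-++⁺ʳ as z∈bs

module _ {U : Set ℓ} {X Y : Subset U} where

  size-mono : X ⊆ Y → HasSize X m → HasSize Y n → m ≤ n
  size-mono X⊆Y (_ , u , refl , _ , xs⊆X) (_ , _ , refl , Y⊆ys , _) =
    Unique∧⊆⇒length≤ u (λ p → Y⊆ys (X⊆Y (xs⊆X p)))

  size-resp-≐ : X ≐ Y → HasSize X n → HasSize Y n
  size-resp-≐ (X⊆Y , Y⊆X) (xs , u , l , X⊆xs , xs⊆X) =
    xs , u , l , (λ y → X⊆xs (Y⊆X y)) , (λ p → X⊆Y (xs⊆X p))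

  size-∪ : Empty (X ∩ Y) → HasSize X m → HasSize Y n → HasSize (X ∪ Y) (m + n)
  size-∪ X⊥Y (xs , u , refl , X⊆xs , xs⊆X) (ys , v , refl , Y⊆ys , ys⊆Y) =
    xs ++ ys , ++⁺ u v (λ (p , q) → X⊥Y _ (xs⊆X p , ys⊆Y q)) , length-++ xs ,
    [ (λ x → ∈-++⁺ˡ (X⊆xs x)) , (λ y → ∈-++⁺ʳ xs (Y⊆ys y)) ] ,
    (λ p → [ (λ q → inj₁ (xs⊆X q)) , (λ q → inj₂ (ys⊆Y q)) ] (∈-++⁻ xs p))

size-unique : {X : Subset U} → HasSize X m → HasSize X n → m ≡ n
size-unique sX sX′ = ≤-antisym (size-mono id sX sX′) (size-mono id sX′ sX)

size-∅ : HasSize {U = U} ∅ 0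
size-∅ = [] , [] , refl , (λ ()) , λ ()

size-suc⇒∃ : {X : Subset U} → HasSize X (suc n) → ∃ X
size-suc⇒∃ (x ∷ _ , _ , _ , _ , xs⊆X) = x , xs⊆X (here refl)

size-｛｝ : {x : U} → HasSize ｛ x ｝ 1
size-｛｝ = _ ∷ [] , [] ∷ [] , refl , (λ { refl → here refl }) , λ { (here refl) → refl }

size-insert : {X : Subset U} {e : U} → e ∉ X → HasSize X n → HasSize (X ∪ ｛ e ｝) (suc n)
size-insert {n = n} e∉X sX =
  subst (HasSize _) (+-comm n 1) (size-∪ (λ { _ (x∈X , refl) → e∉X x∈X }) sX size-｛｝)

-- The right summand is counted first, so that zero or one new point computes to `m` or `suc m`
-- definitionally.
size-⊎ : {U W : Set ℓ} {X : Subset (U ⊎ W)} →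
         HasSize (X ∘ inj₁) m → HasSize (X ∘ inj₂) n → HasSize X (n + m)
size-⊎ {m = m} {n = n} {X = X} (xs , u , refl , X⊆xs , xs⊆X) (ys , v , refl , X⊆ys , ys⊆X) =
  map inj₁ xs ++ map inj₂ ys ,
  ++⁺ (map⁺ inj₁-injective u) (map⁺ inj₂-injective v) disjoint ,
  trans (length-++ (map inj₁ xs))
    (trans (cong₂ _+_ (length-map inj₁ xs) (length-map inj₂ ys)) (+-comm m n)) ,
  to , from
  where
  disjoint : ∀ {z} → ¬ (z ∈ˡ map inj₁ xs × z ∈ˡ map inj₂ ys)
  disjoint (p , q) with ∈-map⁻ inj₁ p | ∈-map⁻ inj₂ q
  ... | _ , _ , refl | _ , _ , ()

  to : X ⊆ (_∈ˡ (map inj₁ xs ++ map inj₂ ys))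
  to {inj₁ _} x = ∈-++⁺ˡ (∈-map⁺ inj₁ (X⊆xs x))
  to {inj₂ _} y = ∈-++⁺ʳ (map inj₁ xs) (∈-map⁺ inj₂ (X⊆ys y))

  from : (_∈ˡ (map inj₁ xs ++ map inj₂ ys)) ⊆ X
  from z∈ with ∈-++⁻ (map inj₁ xs) z∈
  ... | inj₁ p with _ , q , refl ← ∈-map⁻ inj₁ p = xs⊆X q
  ... | inj₂ p with _ , q , refl ← ∈-map⁻ inj₂ p = ys⊆X q

-- Rank bounds, closed sets and extension of independent sets.

indep-size : {I : Subset U} (M : Matroid U) → Indep M I → ∃ (HasSize I)
indep-size M i = let n , _ , sI = proj₂ (finite-rank M) i in n , sI

-- The upper half of `HasRank`; it passes to an amalgam without a choice of basis.
RankBound : {U : Set ℓ} → Matroid U → Subset U → ℕ → Set (lsuc ℓ)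
RankBound M X a = ∀ {I n} → I ⊆ X → Indep M I → HasSize I n → n ≤ a

-- Flatness in terms of independent sets alone, a form that carries over to direct sums.
Closed : {U : Set ℓ} → Matroid U → Subset U → Set (lsuc ℓ)
Closed M X = ∀ {I e} → I ⊆ X → Indep M I → e ∈ E M → e ∉ X → Indep M (I ∪ ｛ e ｝)

HasRank-unique : {X : Subset U} (M : Matroid U) → HasRank M X m → HasRank M X n → m ≡ n
HasRank-unique M ((_ , I⊆X , i , sI) , bound) ((_ , J⊆X , j , sJ) , bound′) =
  ≤-antisym (bound′ I⊆X i sI) (bound J⊆X j sJ)

extend : {I J : Subset U} (M : Matroid U) → Indep M I → Indep M J →
         HasSize I m → HasSize J n →
         ∃ λ L → Indep M L × I ⊆ L × L ⊆ I ∪ J × ∃ λ l → n ≤ l × HasSize L l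
extend {n = n} {J = J} M i₀ j sI₀ sJ = go n i₀ sI₀ (m≤m+n n _)
  where
  go : ∀ {I m} k → Indep M I → HasSize I m → n ≤ k + m →
       ∃ λ L → Indep M L × I ⊆ L × L ⊆ I ∪ J × ∃ λ l → n ≤ l × HasSize L l
  go zero i sI n≤m = _ , i , id , inj₁ , _ , n≤m , sI
  go {I} {m} (suc k) i sI n≤ with n ≤? m
  ... | yes n≤m = _ , i , id , inj₁ , _ , n≤m , sI
  ... | no n≰m =
    let e , e∈J , e∉I , i+e = indep-augment M i j sI sJ (≰⇒> n≰m)
        L , l , I+e⊆L , L⊆ , size =
          go k i+e (size-insert e∉I sI) (subst (n ≤_) (sym (+-suc k m)) n≤)
    in  L , l , (λ x∈I → I+e⊆L (inj₁ x∈I)) , (λ x∈L → absorb {I} e∈J (L⊆ x∈L)) , size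
    where
    absorb : ∀ {I e} → e ∈ J → (I ∪ ｛ e ｝) ∪ J ⊆ I ∪ J
    absorb _   (inj₁ (inj₁ x∈I))  = inj₁ x∈I
    absorb e∈J (inj₁ (inj₂ refl)) = inj₂ e∈J
    absorb _   (inj₂ x∈J)         = inj₂ x∈J

-- Isomorphic copies in a larger ground type, and transfer to amalgams.

extension⇒≅ : {U W : Set ℓ} (M : Matroid U) (N : Matroid (U ⊎ W)) → E N ≐ (E M ⟨⊎⟩ ∅) →
              (∀ I → I ⊆ E N → Indep N I ⇔ Indep M (I ∘ inj₁)) → N ≅ M
extension⇒≅ {W = W} M N (⊆E , E⊆) indep = φ , λ I I⊆E → mk⇔
  (λ i → indep-⊆ M (image⊆ I) (Equivalence.to (indep I I⊆E) i))
  (λ i → Equivalence.from (indep I I⊆E) (indep-⊆ M (⊆image I I⊆E) i))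
  where
  to : ∃ (E N) → ∃ (E M)
  to (inj₁ u , p) = u , ⊆E p
  to (inj₂ w , p) = ⊥-elim (lower (⊆E p))

  φ : Bijection (elements N) (elements M)
  φ = record
    { to        = to
    ; cong      = λ {x} {y} → to-cong x y
    ; bijective = (λ {x} {y} → to-injective x y) ,
                  λ (u , p) → (inj₁ u , E⊆ p) , λ { {inj₁ _ , _} refl → refl }
    }
    where
    to-cong : ∀ x y → proj₁ x ≡ proj₁ y → proj₁ (to x) ≡ proj₁ (to y)
    to-cong (inj₁ _ , _) (inj₁ _ , _) refl = refl
    to-cong (inj₂ _ , p) _            _    = ⊥-elim (lower (⊆E p))

    to-injective : ∀ x y → proj₁ (to x) ≡ proj₁ (to y) → proj₁ x ≡ proj₁ y
    to-injective (inj₁ _ , _) (inj₁ _ , _) refl = refl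
    to-injective (inj₂ _ , p) _            _    = ⊥-elim (lower (⊆E p))
    to-injective _            (inj₂ _ , p) _    = ⊥-elim (lower (⊆E p))

  image⊆ : ∀ I → image N M φ I ⊆ I ∘ inj₁
  image⊆ I ((inj₁ _ , _) , u∈I , refl) = u∈I
  image⊆ I ((inj₂ _ , p) , _)          = ⊥-elim (lower (⊆E p))

  ⊆image : ∀ I → I ⊆ E N → I ∘ inj₁ ⊆ image N M φ I
  ⊆image I I⊆E u∈I = (inj₁ _ , I⊆E u∈I) , u∈I , refl

amalgam-indep : (A N : Matroid U) {I : Subset U} → A ∣ E N ≈ N → Indep N I → Indep A I
amalgam-indep _ _ (_ , eq) i = proj₁ (Equivalence.from (eq _) i)

amalgam-rank : {X : Subset U} (A N : Matroid U) → A ∣ E N ≈ N → X ⊆ E N →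
               RankBound N X a → RankBound A X a
amalgam-rank A N (_ , eq) X⊆E rX I⊆X i sI =
  rX I⊆X (Equivalence.to (eq _) (i , λ x∈I → X⊆E (I⊆X x∈I))) sI

-- Classical finiteness, submodularity and flats.

module _ {ℓ} (em : ExcludedMiddle (lsuc ℓ)) where

  dec : (P : Set ℓ) → Dec P
  dec P = map′ lower lift (em {Lift (lsuc ℓ) P})

  finite-⊆ : {U : Set ℓ} {X Y : Subset U} → X ⊆ Y → HasSize Y n → ∃ λ m → m ≤ n × HasSize X m
  finite-⊆ {X = X} X⊆Y (ys , u , refl , Y⊆ys , _) =
    _ , length-filter X? ys ,
    (filter X? ys , filter⁺ X? u , refl ,
     (λ x∈X → ∈-filter⁺ X? (Y⊆ys (X⊆Y x∈X)) x∈X) ,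
     (λ p → proj₂ (∈-filter⁻ X? {xs = ys} p)))
    where X? = λ x → dec (X x)

  ⊆∧size⇒⊇ : {U : Set ℓ} {X Y : Subset U} → X ⊆ Y → HasSize X n → HasSize Y n → Y ⊆ X
  ⊆∧size⇒⊇ {X = X} X⊆Y sX sY {y} y∈Y with dec (X y)
  ... | yes y∈X = y∈X
  ... | no y∉X =
    contradiction (size-mono [ X⊆Y , (λ { refl → y∈Y }) ] (size-insert y∉X sX) sY) 1+n≰n

  ⊈⇒∃ : {U : Set ℓ} {X Y : Subset U} → ¬ (X ⊆ Y) → ∃ λ x → x ∈ X × x ∉ Y
  ⊈⇒∃ {X = X} {Y} X⊈Y with dec (∃ λ x → x ∈ X × x ∉ Y)
  ... | yes p = p
  ... | no ¬p = ⊥-elim (X⊈Y X⊆Y)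
    where
    X⊆Y : X ⊆ Y
    X⊆Y {x} x∈X with dec (Y x)
    ... | yes x∈Y = x∈Y
    ... | no x∉Y = contradiction (x , x∈X , x∉Y) ¬p

  -- Submodularity of the rank function, with the ranks of X ∩ Y and X ∪ Y
  -- replaced by the sizes of arbitrary independent subsets J and K.
  rank-submodular : {U : Set ℓ} {X Y J K : Subset U} (M : Matroid U) →
                    RankBound M X a → RankBound M Y b →
                    J ⊆ X ∩ Y → Indep M J → HasSize J j →
                    K ⊆ X ∪ Y → Indep M K → HasSize K k → j + k ≤ a + b
  rank-submodular {a = a} {b = b} {j = j} {k = k} {X = X} {Y} {J} M rX rY J⊆ iJ sJ K⊆ iK sK =
    -- `L` extends `J` by elements of `K` and is at least as large as `K`. Its part in `X` is
    -- bounded by `a`; the rest of `L` together with `J` lies in `Y` and is bounded by `b`.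
    let L , iL , J⊆L , L⊆J∪K , l , k≤l , sL = extend M iJ iK sJ sK
        iL∩X = indep-⊆ M {J = L ∩ X} proj₁ iL
        iL∖X = indep-⊆ M {J = L ∖ X} proj₁ iL
        x , sL∩X = indep-size M iL∩X
        y , sL∖X = indep-size M iL∖X
        l≤x+y : l ≤ x + y
        l≤x+y = size-mono (split L) sL (size-∪ (λ _ ((_ , x∈X) , (_ , x∉X)) → x∉X x∈X) sL∩X sL∖X)
        L∖X∪J⊆Y : (L ∖ X) ∪ J ⊆ Y
        L∖X∪J⊆Y = λ
          { (inj₁ (x∈L , x∉X)) →
              [ proj₂ ∘ J⊆ , (λ x∈K → [ (λ x∈X → contradiction x∈X x∉X) , id ] (K⊆ x∈K)) ] (L⊆J∪K x∈L)
          ; (inj₂ x∈J) → proj₂ (J⊆ x∈J) }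
        y+j≤b : y + j ≤ b
        y+j≤b = rY L∖X∪J⊆Y (indep-⊆ M [ proj₁ , J⊆L ] iL)
                   (size-∪ (λ _ ((_ , x∉X) , x∈J) → x∉X (proj₁ (J⊆ x∈J))) sL∖X sJ)
        open ≤-Reasoning
    in  begin
          j + k        ≤⟨ +-monoʳ-≤ j (≤-trans k≤l l≤x+y) ⟩
          j + (x + y)  ≡⟨ +-comm j (x + y) ⟩
          x + y + j    ≡⟨ +-assoc x y j ⟩
          x + (y + j)  ≤⟨ +-mono-≤ (rX proj₂ iL∩X sL∩X) y+j≤b ⟩
          a + b        ∎
    where
    split : ∀ L → L ⊆ (L ∩ X) ∪ (L ∖ X)
    split L {z} z∈L with dec (X z)
    ... | yes z∈X = inj₁ (z∈L , z∈X)
    ... | no z∉X = inj₂ (z∈L , z∉X)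

  -- If `I ∪ ｛ e ｝` were dependent, any independent `J ⊆ F ∪ ｛ e ｝` could be traded for an `L` at
  -- least as large, grown from `I` and hence avoiding `e`. Then `L ⊆ F`, so adding `e` would not
  -- raise the rank of `F`.
  flat⇒closed : {U : Set ℓ} {F : Subset U} (M : Matroid U) →
                IsFlat M F → HasRank M F k → Closed M F
  flat⇒closed {k = k} {F = F} M (_ , flat) rF@((B , B⊆F , iB , sB) , bound) {I} {e} I⊆F i e∈E e∉F
    with dec (Indep M (I ∪ ｛ e ｝))
  ... | yes i+e = i+e
  ... | no ¬i+e =
    contradiction (flat e∈E rF ((B , (λ x∈B → inj₁ (B⊆F x∈B)) , iB , sB) , bound+e)) e∉F
    where
    bound+e : RankBound M (F ∪ ｛ e ｝) k
    bound+e {J} J⊆F+e iJ sJ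
      with L , iL , I⊆L , L⊆I∪J , l , n≤l , sL ← extend M i iJ (proj₂ (indep-size M i)) sJ
      with dec (L e)
    ... | yes e∈L = contradiction (indep-⊆ M [ I⊆L , (λ { refl → e∈L }) ] iL) ¬i+e
    ... | no e∉L = ≤-trans n≤l (bound L⊆F iL sL)
      where
      L⊆F : L ⊆ F
      L⊆F x∈L with L⊆I∪J x∈L
      ... | inj₁ x∈I = I⊆F x∈I
      ... | inj₂ x∈J with J⊆F+e x∈J
      ...   | inj₁ x∈F = x∈F
      ...   | inj₂ refl = contradiction x∈L e∉L

  -- Free extension and truncation of matroids.

  -- The direct sum of `M` with the free matroid on `W`: all new elements are coloops.
  freeSum : {U W : Set ℓ} → Matroid U → HasSize {U = W} Full n → Matroid (U ⊎ W)
  freeSum {n = w} {U = U} {W} M sW = record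
    { E             = E M ⟨⊎⟩ Full
    ; Indep         = λ I → Indep M (I ∘ inj₁)
    ; indep-ground  = λ { i {inj₁ _} x∈I → indep-ground M i x∈I ; i {inj₂ _} _ → tt }
    ; indep-∅       = indep-∅ M
    ; indep-⊆       = λ J⊆I → indep-⊆ M J⊆I
    ; indep-augment = augment
    ; finite-rank   = let k , bound = finite-rank M in w + k , λ i →
        let a , a≤k , s₁ = bound i
            b , b≤w , s₂ = finite-⊆ (λ _ → tt) sW
        in  b + a , +-mono-≤ b≤w a≤k , size-⊎ s₁ s₂
    }
    where
    augment : ∀ {I J m n} → Indep M (I ∘ inj₁) → Indep M (J ∘ inj₁) →
              HasSize I m → HasSize J n → m < n →
              ∃ λ e → e ∈ J × e ∉ I × Indep M ((I ∪ ｛ e ｝) ∘ inj₁)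
    augment {I} {J} {m} {n} i j sI sJ m<n
      with dec ((J ∘ inj₂) ⊆ (I ∘ inj₂))
    -- A new element of `J` outside `I` can be added freely; if there is none, `J` must outnumber
    -- `I` in the left part.
    ... | no J₂⊈I₂ =
      let e , e∈J , e∉I = ⊈⇒∃ J₂⊈I₂
      in  inj₂ e , e∈J , e∉I , indep-⊆ M (λ { (inj₁ x∈I) → x∈I ; (inj₂ ()) }) i
    ... | yes J₂⊆I₂ =
      let a , s₁ = indep-size M i
          c , t₁ = indep-size M j
          b , _ , s₂ = finite-⊆ {X = I ∘ inj₂} (λ _ → tt) sW
          d , _ , t₂ = finite-⊆ {X = J ∘ inj₂} (λ _ → tt) sW
          b+a<d+c : b + a < d + c
          b+a<d+c = subst (_< d + c) (size-unique sI (size-⊎ s₁ s₂))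
                      (subst (m <_) (size-unique sJ (size-⊎ t₁ t₂)) m<n)
          a<c = +-cancelˡ-< b a c (<-≤-trans b+a<d+c (+-monoˡ-≤ c (size-mono J₂⊆I₂ t₂ s₂)))
          e , e∈J , e∉I , i+e = indep-augment M i j s₁ t₁ a<c
      in  inj₁ e , e∈J , e∉I ,
          indep-⊆ M (λ { (inj₁ x∈I) → inj₁ x∈I ; (inj₂ refl) → inj₂ refl }) i+e

  module _ {U W : Set ℓ} (M : Matroid U) (sW : HasSize {U = W} Full n) where

    -- Coloops create no dependence, so any `Y` may be attached to a closed set.
    freeSum-closed : {X : Subset U} (Y : Subset W) →
                     Closed M X → Closed (freeSum M sW) (X ⟨⊎⟩ Y)
    freeSum-closed Y closed {e = inj₁ e} I⊆ i e∈E e∉X =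
      indep-⊆ M (λ { (inj₁ x∈I) → inj₁ x∈I ; (inj₂ refl) → inj₂ refl }) (closed I⊆ i e∈E e∉X)
    freeSum-closed Y closed {e = inj₂ e} I⊆ i e∈E e∉X =
      indep-⊆ M (λ { (inj₁ x∈I) → x∈I ; (inj₂ ()) }) i

    freeSum-rank : {X : Subset U} {Y : Subset W} → RankBound M X a → HasSize Y b →
                   RankBound (freeSum M sW) (X ⟨⊎⟩ Y) (b + a)
    freeSum-rank rX sY I⊆ i sI =
      let a , s₁ = indep-size M i
          b , b≤ , s₂ = finite-⊆ I⊆ sY
      in  subst (_≤ _) (size-unique (size-⊎ s₁ s₂) sI) (+-mono-≤ b≤ (rX I⊆ i s₁))

  -- The truncation of K to rank t = 2 + s in which the flats F i become
  -- hyperplanes: the bases contained in some F i are removed.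
  module Cut {U : Set ℓ} (K : Matroid U) (s : ℕ) {Ix : Set} (F : Ix → Subset U)
             (closed : ∀ i → Closed K (F i))
             (meet : ∀ {i i′} → i ≢ i′ → RankBound K (F i ∩ F i′) s) where

    CutIndep : Subset U → Set ℓ
    CutIndep I = Indep K I × (∀ {n} → HasSize I n → n ≤ 2 + s)
                           × (HasSize I (2 + s) → ∀ i → ¬ (I ⊆ F i))

    indep-small : ∀ {I} → Indep K I → HasSize I n → n < 2 + s → CutIndep I
    indep-small {n = n} i sI n<t =
      i , (λ sI′ → subst (_≤ 2 + s) (size-unique sI sI′) (<⇒≤ n<t)) ,
      (λ sI′ → contradiction (size-unique sI sI′) (<⇒≢ n<t))

    indep-basis : ∀ {I} → Indep K I → HasSize I (2 + s) → (∀ i → ¬ (I ⊆ F i)) → CutIndep I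
    indep-basis i sI I⊈F = i , (λ sI′ → ≤-reflexive (size-unique sI′ sI)) , λ _ → I⊈F

    -- Only sizes `1 + s` and `2 + s` need care. If `I` lies in some `F x`, an element of `J`
    -- outside `F x` is added; no other `F x′` contains the result, since `I` is too large for the
    -- intersection. If `I` lies in no `F x`, any exchange in `K` works.
    augment : ∀ {I J m n} → CutIndep I → CutIndep J → HasSize I m → HasSize J n → m < n →
              ∃ λ e → e ∈ J × e ∉ I × CutIndep (I ∪ ｛ e ｝)
    augment {I} {J} {m} {n} (i , _) (j , J≤t , J⊈F) sI sJ m<n
      with suc m <? 2 + s
    ... | yes 1+m<t =
      let e , e∈J , e∉I , i+e = indep-augment K i j sI sJ m<n
      in  e , e∈J , e∉I , indep-small i+e (size-insert e∉I sI) 1+m<t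
    ... | no 1+m≮t with ≤-antisym (≤-trans m<n (J≤t sJ)) (≮⇒≥ 1+m≮t)
    ...   | refl with ≤-antisym m<n (J≤t sJ)
    ...     | refl with em {∃ λ x → Lift (lsuc ℓ) (I ⊆ F x)}
    ...       | yes (x , lift I⊆F) =
      let e , e∈J , e∉F = ⊈⇒∃ (J⊈F sJ x)
          e∉I = λ e∈I → e∉F (I⊆F e∈I)
          i+e = closed x I⊆F i (indep-ground K j e∈J) e∉F
      in  e , e∈J , e∉I , indep-basis i+e (size-insert e∉I sI) λ x′ I+e⊆F′ →
          1+n≰n (meet (λ { refl → e∉F (I+e⊆F′ (inj₂ refl)) })
                      (λ z∈I → I⊆F z∈I , I+e⊆F′ (inj₁ z∈I)) i sI)
    ...       | no I⊈F =
      let e , e∈J , e∉I , i+e = indep-augment K i j sI sJ m<n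
      in  e , e∈J , e∉I , indep-basis i+e (size-insert e∉I sI) λ x I+e⊆F →
          I⊈F (x , lift (λ z∈I → I+e⊆F (inj₁ z∈I)))

    cut : Matroid U
    cut = record
      { E             = E K
      ; Indep         = CutIndep
      ; indep-ground  = λ (i , _) → indep-ground K i
      ; indep-∅       = indep-small (indep-∅ K) size-∅ (s≤s z≤n)
      ; indep-⊆       = λ J⊆I (i , I≤t , I⊈F) →
          let n , sI = indep-size K i
          in  indep-⊆ K J⊆I i ,
              (λ sJ → ≤-trans (size-mono J⊆I sJ sI) (I≤t sI)) ,
              -- A subset `J` of full size is all of `I`, so it is not inside `F x` either.
              (λ sJ x J⊆F →
                 let sI′ = subst (HasSize _) (≤-antisym (I≤t sI) (size-mono J⊆I sJ sI)) sI
                 in  I⊈F sI′ x (λ z∈I → J⊆F (⊆∧size⇒⊇ J⊆I sJ sI′ z∈I)))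
      ; indep-augment = augment
      ; finite-rank   = 2 + s , λ (i , I≤t , _) → let n , sI = indep-size K i in n , I≤t sI , sI
      }

    cut-rank : ∀ x → RankBound cut (F x) (1 + s)
    cut-rank x I⊆F (_ , I≤t , I⊈F) sI =
      ≤-pred (≤∧≢⇒< (I≤t sI) (λ { refl → I⊈F sI x I⊆F }))

  -- r = 3 + q, the hyperplanes are side true and side false, P is
  -- Block nothing, and C and D are Block (just true) and Block (just false).
  module Vamos {U : Set ℓ} (M : Matroid U) (q : ℕ) (rE : RankBound M (E M) (3 + q))
               (side : Bool → Subset U) (side⊆E : ∀ a → side a ⊆ E M)
               (side-closed : ∀ a → Closed M (side a))
               (side-rank : ∀ a → HasRank M (side a) (2 + q))
               (side-disjoint : ∀ {a b u} → a ≢ b → u ∈ side a → u ∉ side b) where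

    -- The blocks of new elements.

    -- The sizes are r - 2, r - 1 and 2. `C ∪ D` gets r + 1 elements, the rank of `N′`, while
    -- neither exceeds r - 1; for `D` this holds because r ≥ 3.
    blockSize : Maybe Bool → ℕ
    blockSize nothing      = 1 + q
    blockSize (just true)  = 2 + q
    blockSize (just false) = 2

    -- Lifted so that `U ⊎ New` lies in the universe over which `Sticky` quantifies.
    New : Set ℓ
    New = Lift ℓ (∃ λ l → Fin (blockSize l))

    Block : Maybe Bool → Subset New
    Block l (lift (l′ , _)) = Lift ℓ (l ≡ l′)

    Sides : Subset New
    Sides = Block (just true) ∪ Block (just false)

    Block⊆Sides : ∀ b → Block (just b) ⊆ Sides
    Block⊆Sides true  = inj₁
    Block⊆Sides false = inj₂

    size-Block : ∀ l → HasSize (Block l) (blockSize l)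
    size-Block l =
      map f (allFin _) , map⁺ (λ { refl → refl }) (allFin⁺ _) ,
      trans (length-map f (allFin _)) (length-tabulate id) ,
      (λ { {lift (_ , i)} (lift refl) → ∈-map⁺ f (∈-allFin i) }) , from
      where
      f : Fin (blockSize l) → New
      f i = lift (l , i)
      from : (_∈ˡ map f (allFin _)) ⊆ Block l
      from p with _ , _ , refl ← ∈-map⁻ f p = lift refl

    size-Sides : HasSize Sides (4 + q)
    size-Sides = subst (HasSize Sides) (+-comm (2 + q) 2)
      (size-∪ (λ { _ (lift refl , lift ()) }) (size-Block (just true)) (size-Block (just false)))

    size-New : HasSize Full ((1 + q) + (4 + q))
    size-New = size-resp-≐ ((λ _ → tt) , λ {x} _ → cover x)
      (size-∪ (λ { _ (lift refl , inj₁ (lift ())) ; _ (lift refl , inj₂ (lift ())) })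
              (size-Block nothing) size-Sides)
      where
      cover : ∀ x → x ∈ Block nothing ∪ Sides
      cover (lift (nothing , _))    = inj₁ (lift refl)
      cover (lift (just true , _))  = inj₂ (inj₁ (lift refl))
      cover (lift (just false , _)) = inj₂ (inj₂ (lift refl))

    new : Subset New → Subset (U ⊎ New)
    new Y = ∅ ⟨⊎⟩ Y

    -- All blocks are attached at once, so that both extensions arise from one matroid by cutting
    -- and restricting.
    K : Matroid (U ⊎ New)
    K = freeSum M size-New

    ∅-rank : RankBound M ∅ 0
    ∅-rank I⊆∅ _ sI = size-mono I⊆∅ sI size-∅

    K-Block-rank : ∀ l → RankBound K (new (Block l)) (blockSize l)
    K-Block-rank l I⊆ i sI =
      ≤-trans (freeSum-rank M size-New ∅-rank (size-Block l) I⊆ i sI) (≤-reflexive (+-identityʳ _))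

    K-side-rank : ∀ a → RankBound K (side a ⟨⊎⟩ ∅) (2 + q)
    K-side-rank a = freeSum-rank M size-New (proj₂ (side-rank a)) size-∅

    blockSize≤ : ∀ b → blockSize (just b) ≤ 2 + q
    blockSize≤ true  = ≤-refl
    blockSize≤ false = s≤s (s≤s z≤n)

    -- The sets prescribed as hyperplanes.

    F : Bool → Subset (U ⊎ New)
    F a = side a ⟨⊎⟩ Block nothing

    -- As the sides are disjoint, only `P` is common, and it has `1 + q` elements.
    F-meet : ∀ {a a′} → a ≢ a′ → RankBound K (F a ∩ F a′) (1 + q)
    F-meet {a} {a′} a≢a′ I⊆ = K-Block-rank nothing λ {z} z∈I → F∩F⊆ {z} (I⊆ z∈I)
      where
      F∩F⊆ : F a ∩ F a′ ⊆ new (Block nothing)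
      F∩F⊆ {inj₁ _} (p , p′) = contradiction p′ (side-disjoint a≢a′ p)
      F∩F⊆ {inj₂ _} (p , _)  = p

    F′ : Bool × Bool → Subset (U ⊎ New)
    F′ (a , b) = side a ⟨⊎⟩ Block (just b)

    -- On the same side the blocks differ, leaving that side, of rank r - 1; on different sides at
    -- most one block is shared.
    F′-meet : ∀ {x x′} → x ≢ x′ → RankBound K (F′ x ∩ F′ x′) (2 + q)
    F′-meet {a , b} {a′ , b′} x≢x′ {n = n} I⊆ i sI with a ≟ᵇ a′
    ... | yes refl = K-side-rank a (λ {z} z∈I → F′∩F′⊆ {z} (I⊆ z∈I)) i sI
      where
      F′∩F′⊆ : F′ (a , b) ∩ F′ (a , b′) ⊆ (side a ⟨⊎⟩ ∅)
      F′∩F′⊆ {inj₁ _} (p , _)                     = p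
      F′∩F′⊆ {inj₂ _} (lift refl , lift refl) = contradiction refl x≢x′
    ... | no a≢a′ = ≤-trans (K-Block-rank (just b) (λ {z} z∈I → F′∩F′⊆ {z} (I⊆ z∈I)) i sI) (blockSize≤ b)
      where
      F′∩F′⊆ : F′ (a , b) ∩ F′ (a′ , b′) ⊆ new (Block (just b))
      F′∩F′⊆ {inj₁ _} (p , p′) = contradiction p′ (side-disjoint a≢a′ p)
      F′∩F′⊆ {inj₂ _} (p , _)  = p

    module C  = Cut K (1 + q) F
                  (λ a → freeSum-closed M size-New (Block nothing) (side-closed a)) F-meet
    module C′ = Cut K (2 + q) F′
                  (λ (a , b) → freeSum-closed M size-New (Block (just b)) (side-closed a)) F′-meet

    -- The two extensions and their agreement on `M`.

    N N′ : Matroid (U ⊎ New)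
    N  = C.cut ∣ (Full ⟨⊎⟩ Block nothing)
    N′ = C′.cut ∣ (Full ⟨⊎⟩ Sides)

    T : Subset (U ⊎ New)
    T = E N ∩ E N′

    T⊆ : T ⊆ (E M ⟨⊎⟩ ∅)
    T⊆ {inj₁ _} ((p , _) , _) = p
    T⊆ {inj₂ _} ((_ , lift refl) , (_ , inj₁ (lift ())))
    T⊆ {inj₂ _} ((_ , lift refl) , (_ , inj₂ (lift ())))

    ⊆T : (E M ⟨⊎⟩ ∅) ⊆ T
    ⊆T {inj₁ _} p = (p , tt) , (p , tt)

    old : (Y : Subset New) → (E M ⟨⊎⟩ ∅) ⊆ (Full ⟨⊎⟩ Y)
    old _ {inj₁ _} _ = tt

    -- Without new elements, a subset of `F a` lies in `side a`, of rank r - 1; so the cut removes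
    -- no basis of `M`.
    N-indep : ∀ {I} → I ⊆ (E M ⟨⊎⟩ ∅) → Indep M (I ∘ inj₁) → Indep N I
    N-indep {I} I⊆ i =
      (i , (λ sI → freeSum-rank M size-New rE size-∅ I⊆ i sI) ,
           λ sI a I⊆F → 1+n≰n (K-side-rank a (I⊆side a I⊆F) i sI)) ,
      λ {z} z∈I → old (Block nothing) {z} (I⊆ z∈I)
      where
      I⊆side : ∀ a → I ⊆ F a → I ⊆ (side a ⟨⊎⟩ ∅)
      I⊆side a I⊆F {inj₁ _} z∈I = I⊆F z∈I
      I⊆side a I⊆F {inj₂ _} z∈I = I⊆ z∈I

    -- Independent sets of `M` have at most r elements, too few for the cut at size r + 1 to affect
    -- them.
    N′-indep : ∀ {I} → I ⊆ (E M ⟨⊎⟩ ∅) → Indep M (I ∘ inj₁) → Indep N′ I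
    N′-indep I⊆ i =
      let n , sI = indep-size K i
      in  C′.indep-small i sI (s≤s (freeSum-rank M size-New rE size-∅ I⊆ i sI)) ,
          λ {z} z∈I → old Sides {z} (I⊆ z∈I)

    N∣T≈N′∣T : N ∣ T ≈ N′ ∣ T
    N∣T≈N′∣T =
      ((λ (_ , t) → proj₂ t , t) , (λ (_ , t) → proj₁ t , t)) ,
      λ I → mk⇔ (λ (((i , _) , _) , I⊆T) → N′-indep (λ {z} z∈I → T⊆ {z} (I⊆T z∈I)) i , I⊆T)
                (λ (((i , _) , _) , I⊆T) → N-indep (λ {z} z∈I → T⊆ {z} (I⊆T z∈I)) i , I⊆T)

    N∣T≅M : N ∣ T ≅ M
    N∣T≅M = extension⇒≅ M (N ∣ T)
      ((λ {z} (_ , t) → T⊆ {z} t) , (λ {z} p → proj₁ (⊆T {z} p) , ⊆T {z} p))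
      λ I I⊆ → mk⇔ (λ (((i , _) , _) , _) → i)
                   (λ i → N-indep (λ {z} z∈I → T⊆ {z} (proj₂ (I⊆ z∈I))) i , λ {_} z∈I → proj₂ (I⊆ z∈I))

    N′∣T≅M : N′ ∣ T ≅ M
    N′∣T≅M = extension⇒≅ M (N′ ∣ T)
      ((λ {z} (_ , t) → T⊆ {z} t) , (λ {z} p → proj₂ (⊆T {z} p) , ⊆T {z} p))
      λ I I⊆ → mk⇔ (λ (((i , _) , _) , _) → i)
                   (λ i → N′-indep (λ {z} z∈I → T⊆ {z} (proj₂ (I⊆ z∈I))) i , λ {_} z∈I → proj₂ (I⊆ z∈I))

    -- Independent sets that supply the lower bounds.

    basis : Bool → Subset U
    basis a = proj₁ (proj₁ (side-rank a))

    basis⊆side : ∀ a → basis a ⊆ side a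
    basis⊆side a = proj₁ (proj₂ (proj₁ (side-rank a)))

    basis-indep : ∀ a → Indep M (basis a)
    basis-indep a = proj₁ (proj₂ (proj₂ (proj₁ (side-rank a))))

    size-basis : ∀ a → HasSize (basis a) (2 + q)
    size-basis a = proj₂ (proj₂ (proj₂ (proj₁ (side-rank a))))

    basis-point : ∀ a → ∃ (basis a)
    basis-point a = size-suc⇒∃ (size-basis a)

    block-point : ∀ b → ∃ (Block (just b))
    block-point true  = size-suc⇒∃ (size-Block (just true))
    block-point false = size-suc⇒∃ (size-Block (just false))

    -- A basis of `N′` inside the union of both sides and block `b`. Its point of `side false` keeps
    -- it out of `F′ (true , _)`, its basis of `side true` out of `F′ (false , _)`.
    spanning : Bool → Subset (U ⊎ New)
    spanning b = (basis true ∪ ｛ proj₁ (basis-point false) ｝) ⟨⊎⟩ ｛ proj₁ (block-point b) ｝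

    point∉ : proj₁ (basis-point false) ∉ side true
    point∉ = side-disjoint (λ ()) (basis⊆side false (proj₂ (basis-point false)))

    size-spanning : ∀ b → HasSize (spanning b) (4 + q)
    size-spanning b =
      size-⊎ {X = spanning b} (size-insert (λ p → point∉ (basis⊆side true p)) (size-basis true)) size-｛｝

    spanning-indep : ∀ b → Indep N′ (spanning b)
    spanning-indep b =
      C′.indep-basis
        (side-closed true (basis⊆side true) (basis-indep true)
          (side⊆E false (basis⊆side false (proj₂ (basis-point false)))) point∉)
        (size-spanning b) ⊈ ,
      λ { {inj₁ _} _ → tt ; {inj₂ w} refl → Block⊆Sides b {w} (proj₂ (block-point b)) }
      where
      ⊈ : ∀ x → ¬ (spanning b ⊆ F′ x)
      ⊈ (true , _)  ⊆ = point∉ (⊆ {inj₁ _} (inj₂ refl))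
      ⊈ (false , _) ⊆ = let u , u∈ = basis-point true in
        side-disjoint (λ ()) (basis⊆side true u∈) (⊆ {inj₁ u} (inj₁ u∈))

    size-⊎Sides : HasSize (new Sides) (4 + q)
    size-⊎Sides = subst (HasSize (new Sides)) (+-identityʳ _) (size-⊎ size-∅ size-Sides)

    -- `C ∪ D` has full size, and every `F′ x` misses one of the two nonempty blocks.
    Sides-indep : Indep N′ (new Sides)
    Sides-indep = C′.indep-basis {I = new Sides} (indep-∅ M)
        size-⊎Sides ⊈ ,
      λ { {inj₂ _} p → p }
      where
      ⊈ : ∀ x → ¬ (new Sides ⊆ F′ x)
      ⊈ (_ , true)  ⊆ with ⊆ {inj₂ (proj₁ (block-point false))} (inj₂ (proj₂ (block-point false)))
      ... | lift ()
      ⊈ (_ , false) ⊆ with ⊆ {inj₂ (proj₁ (block-point true))} (inj₁ (proj₂ (block-point true)))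
      ... | lift ()

    size-P : HasSize (new (Block nothing)) (1 + q)
    size-P = subst (HasSize (new (Block nothing))) (+-identityʳ _) (size-⊎ size-∅ (size-Block nothing))

    P-indep : Indep N (new (Block nothing))
    P-indep = C.indep-small {I = new (Block nothing)} (indep-∅ M) size-P (s≤s (n≤1+n _)) ,
      λ { {inj₂ _} p → p }

    -- Rank estimates in a supposed amalgam.

    module _ (A : Matroid (U ⊎ New)) (eq : A ∣ E N ≈ N) (eq′ : A ∣ E N′ ≈ N′) where

      F-rank : ∀ a → RankBound A (F a) (2 + q)
      F-rank a = amalgam-rank A N eq (λ {z} → F⊆ {z}) λ I⊆ (i , _) → C.cut-rank a I⊆ i
        where
        F⊆ : F a ⊆ E N
        F⊆ {inj₁ _} p = side⊆E a p , tt
        F⊆ {inj₂ _} p = tt , p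

      F′-rank : ∀ a b → RankBound A (F′ (a , b)) (3 + q)
      F′-rank a b = amalgam-rank A N′ eq′ (λ {z} → F′⊆ {z}) λ I⊆ (i , _) → C′.cut-rank (a , b) I⊆ i
        where
        F′⊆ : F′ (a , b) ⊆ E N′
        F′⊆ {inj₁ _} p = side⊆E a p , tt
        F′⊆ {inj₂ w} p = tt , Block⊆Sides b {w} p

      P∪ : Bool → Subset New
      P∪ b = Block nothing ∪ Block (just b)

      -- `F′ (a , b)` and `F a` share a basis of `side a`, so (2 + q) + n ≤ (3 + q) + (2 + q):
      -- adding `P` costs no rank.
      side∪P∪Block-rank : ∀ a b → RankBound A (side a ⟨⊎⟩ P∪ b) (3 + q)
      side∪P∪Block-rank a b {I} {n} I⊆ i sI =
        +-cancelˡ-≤ (2 + q) n (3 + q) (subst (2 + q + n ≤_) (+-comm (3 + q) (2 + q))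
          (rank-submodular {J = basis a ⟨⊎⟩ ∅} A (F′-rank a b) (F-rank a)
            (λ { {inj₁ _} p → basis⊆side a p , basis⊆side a p })
            (amalgam-indep A N eq
              (N-indep {basis a ⟨⊎⟩ ∅} (λ { {inj₁ _} p → side⊆E a (basis⊆side a p) }) (basis-indep a)))
            (size-⊎ {X = basis a ⟨⊎⟩ ∅} (size-basis a) size-∅) (λ {z} z∈I → cover {z} (I⊆ z∈I)) i sI))
        where
        cover : (side a ⟨⊎⟩ P∪ b) ⊆ F′ (a , b) ∪ F a
        cover {inj₁ _} p        = inj₁ p
        cover {inj₂ _} (inj₁ p) = inj₂ p
        cover {inj₂ _} (inj₂ p) = inj₁ p

      -- `I` itself serves as the set in the intersection and `spanning b` as the one in the union,
      -- giving n + (4 + q) ≤ 2(3 + q).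
      P∪Block-rank : ∀ b → RankBound A (new (P∪ b)) (2 + q)
      P∪Block-rank b {I} {n} I⊆ i sI =
        +-cancelʳ-≤ (4 + q) n (2 + q) (subst (n + (4 + q) ≤_) (sym (+-suc (2 + q) (3 + q)))
          (rank-submodular A (side∪P∪Block-rank true b) (side∪P∪Block-rank false b)
            (λ {z} z∈I → meet {z} (I⊆ z∈I)) i sI
            (λ {z} → cover {z}) (amalgam-indep A N′ eq′ (spanning-indep b)) (size-spanning b)))
        where
        meet : new (P∪ b) ⊆ (side true ⟨⊎⟩ P∪ b) ∩ (side false ⟨⊎⟩ P∪ b)
        meet {inj₂ _} p = p , p
        cover : spanning b ⊆ (side true ⟨⊎⟩ P∪ b) ∪ (side false ⟨⊎⟩ P∪ b)
        cover {inj₁ _} (inj₁ p)    = inj₁ (basis⊆side true p)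
        cover {inj₁ _} (inj₂ refl) = inj₂ (basis⊆side false (proj₂ (basis-point false)))
        cover {inj₂ _} refl        = inj₁ (inj₂ (proj₂ (block-point b)))

      no-amalgam : ⊥
      -- `P` in the intersection and `C ∪ D` in the union give (1 + q) + (4 + q) ≤ 2(2 + q), which
      -- fails by one.
      no-amalgam = 1+n≰n (subst (_≤ 2 + q + (2 + q))
        (cong suc (trans (+-suc q (3 + q)) (cong suc (+-suc q (2 + q)))))
        (rank-submodular {J = new (Block nothing)} {K = new Sides} A
          (P∪Block-rank true) (P∪Block-rank false)
          (λ { {inj₂ _} p → inj₁ p , inj₁ p }) (amalgam-indep A N eq P-indep) size-P
          (λ { {inj₂ _} (inj₁ p) → inj₁ (inj₂ p) ; {inj₂ _} (inj₂ p) → inj₂ (inj₂ p) })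
          (amalgam-indep A N′ eq′ Sides-indep)
          size-⊎Sides))

theorem3p1 : {ℓ : Level} → ExcludedMiddle (lsuc ℓ) →
    {U : Set ℓ} (M : Matroid U) (r : ℕ) → r ≥ 3 → HasRank M (E M) r →
    (H H′ : Subset U) → IsHyperplane M H → IsHyperplane M H′ →
    Empty (H ∩ H′) → ¬ Sticky M
theorem3p1 em {U} M (suc (suc (suc q))) (s≤s (s≤s (s≤s z≤n))) rE H H′
  (flat , k , rH , rE₁) (flat′ , k′ , rH′ , rE₂) H⊥H′ sticky
  -- The rank of `M` recorded with each hyperplane is identified with `3 + q`, so both hyperplanes
  -- have rank `2 + q`.
  with refl ← HasRank-unique M rE₁ rE | refl ← HasRank-unique M rE₂ rE =
  let A , _ , eq , eq′ = sticky N N′ N∣T≈N′∣T N∣T≅M N′∣T≅M in no-amalgam A eq eq′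
  where
  side : Bool → Subset U
  side true  = H
  side false = H′

  disjoint : ∀ {a b u} → a ≢ b → u ∈ side a → u ∉ side b
  disjoint {true}  {true}  a≢b _ _ = a≢b refl
  disjoint {true}  {false} _   p p′ = H⊥H′ _ (p , p′)
  disjoint {false} {true}  _   p p′ = H⊥H′ _ (p′ , p)
  disjoint {false} {false} a≢b _ _ = a≢b refl

  side⊆E : ∀ a → side a ⊆ E M
  side⊆E true  = proj₁ flat
  side⊆E false = proj₁ flat′

  side-rank : ∀ a → HasRank M (side a) (2 + q)
  side-rank true  = rH
  side-rank false = rH′

  side-closed : ∀ a → Closed M (side a)
  side-closed true  = flat⇒closed em M flat rH
  side-closed false = flat⇒closed em M flat′ rH′

  open Vamos em M q (proj₂ rE) side side⊆E side-closed side-rank disjoint
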